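{- For all non-negative integers $n,t$ with $n\equiv 1\pmod 3$ and $t\le n$, we have $$v_3(h(n,t))\ge\begin{cases}0&\text{if } t\equiv 1\pmod 3,\\ 1&\text{if } t\not\equiv 1\pmod 3.\end{cases}$$
   Context: $v_3$ denotes the $3$-adic valuation (on nonzero rational numbers). For integers $n\ge t\ge 0$, define $$h(n,t)=\frac{(2n+1)\,(n+t)!}{(2t+1)!\,(n-t)!}.$$ -}

module Defs where

open import Data.Nat.Base as ℕ
  using (ℕ; zero; suc; _+_; _*_; _∸_; _^_; _!; _≤_; _<_; z≤n; z<s)
open import Data.Nat.Properties
  using (m*n≢0; _!≢0; m≤n⇒m<n∨m≡n; ≤-pred; ≤-trans; <⇒≤; +-mono-≤; m^n>0; m≤n⇒m≤n+o)
open import Data.Nat.Divisibility using (_∣_; _∣?_; ∣⇒≤; 1∣_)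
open import Data.Integer.Base as ℤ using (ℤ; +_; ∣_∣)
open import Data.Rational.Base as ℚ using (ℚ; _/_; ↥_; ↧ₙ_)
open import Data.Rational.Properties using (normalize-pos; pos⇒nonZero)
open import Data.Sum.Base using (inj₁; inj₂)
open import Relation.Binary.PropositionalEquality.Core using (refl)
open import Relation.Nullary.Decidable.Core using (yes; no)
open import Relation.Nullary.Negation.Core using (contradiction)

greatestPower : (n bound : ℕ) → ℕ
greatestPower n zero    = 0
greatestPower n (suc b) with 3 ^ suc b ∣? n
... | yes _ = suc b
... | no  _ = greatestPower n b

-- The greatest k with 3ᵏ ∣ n.  Searching k ≤ n suffices, since 3ᵏ ∣ n
-- forces k < 3ᵏ ≤ n; see 3^v₃ℕ∣n and v₃ℕ-greatest.
v₃ℕ : (n : ℕ) → .{{_ : ℕ.NonZero n}} → ℕ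
v₃ℕ n = greatestPower n n

greatestPower-∣ : ∀ n b → 3 ^ greatestPower n b ∣ n
greatestPower-∣ n zero    = 1∣ n
greatestPower-∣ n (suc b) with 3 ^ suc b ∣? n
... | yes p = p
... | no  _ = greatestPower-∣ n b

greatestPower-max : ∀ n b {k} → k ≤ b → 3 ^ k ∣ n → k ≤ greatestPower n b
greatestPower-max n zero    k≤b _ = k≤b
greatestPower-max n (suc b) k≤b 3^k∣n with 3 ^ suc b ∣? n
... | yes _ = k≤b
... | no ∤n with m≤n⇒m<n∨m≡n k≤b
...   | inj₁ k<1+b = greatestPower-max n b (≤-pred k<1+b) 3^k∣n
...   | inj₂ refl  = contradiction 3^k∣n ∤n

n<3^n : ∀ n → n < 3 ^ n
n<3^n zero    = z<s
n<3^n (suc n) = +-mono-≤ (m^n>0 3 n) (m≤n⇒m≤n+o _ (n<3^n n))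

3^v₃ℕ∣n : ∀ n → .{{_ : ℕ.NonZero n}} → 3 ^ v₃ℕ n ∣ n
3^v₃ℕ∣n n = greatestPower-∣ n n

v₃ℕ-greatest : ∀ n → .{{_ : ℕ.NonZero n}} → ∀ {k} → 3 ^ k ∣ n → k ≤ v₃ℕ n
v₃ℕ-greatest n {k = k} 3^k∣n =
  greatestPower-max n n (≤-trans (<⇒≤ (n<3^n k)) (∣⇒≤ 3^k∣n)) 3^k∣n

↥-nonZero : ∀ q → .{{_ : ℚ.NonZero q}} → ℕ.NonZero ∣ ↥ q ∣
↥-nonZero q@record{} {{q≢0}} = ℕ.≢-nonZero (ℕ.≢-nonZero⁻¹ _ {{q≢0}})

v₃ : (q : ℚ) → .{{_ : ℚ.NonZero q}} → ℤ
v₃ q = + v₃ℕ ∣ ↥ q ∣ {{↥-nonZero q}} ℤ.- + v₃ℕ (↧ₙ q)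

-- Meaningful only for t ≤ n, where n ∸ t is the true difference.
h : ℕ → ℕ → ℚ
h n t = _/_ (+ ((2 * n + 1) * (n + t) !))
            ((2 * t + 1) ! * (n ∸ t) !)
            {{m*n≢0 _ _ {{(2 * t + 1) !≢0}} {{(n ∸ t) !≢0}}}}

h-nonZero : ∀ n t → ℚ.NonZero (h n t)
h-nonZero n t = pos⇒nonZero (h n t) {{normalize-pos _ _ {{den≢0}} {{num≢0}}}}
  where
  den≢0 = m*n≢0 _ _ {{(2 * t + 1) !≢0}} {{(n ∸ t) !≢0}}
  2n+1≢0 : ℕ.NonZero (2 * n + 1)
  2n+1≢0 = ℕ.>-nonZero (+-mono-≤ (z≤n {2 * n}) (z<s {0}))
  num≢0 = m*n≢0 _ _ {{2n+1≢0}} {{(n + t) !≢0}}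

{-# OPTIONS --safe #-}

-- Write D = (2t+1)! (n−t)!.  Since (n+t+1)! + (n−t)(n+t)! = (2n+1)(n+t)! and
-- D divides both summands, h(n,t) is an integer H; moreover
-- (2t+1) H = (2n+1) (n+t choose 2t).  If n ≡ 1 (mod 3), then 3 divides 2n+1,
-- while 3 divides 2t+1 only for t ≡ 1 (mod 3); otherwise 3 must divide H.
module Submission where

open import Defs
open import Data.Nat.Base using (ℕ; _≤_; _%_)
open import Data.Integer.Base as ℤ using (0ℤ; 1ℤ)
open import Data.Product.Base using (_×_)
open import Relation.Binary.PropositionalEquality.Core using (_≡_; _≢_)

open import Data.Nat.Base as ℕ using (zero; suc; _+_; _*_; _∸_; _^_; _!; _/_)
open import Data.Nat.Properties
open import Data.Nat.Combinatorics using ([n∸k]!k!∣n!)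
open import Data.Nat.Divisibility
open import Data.Nat.DivMod
  using (m≡m%n+[m/n]*n; [m+n]%n≡m%n; %-remove-+ʳ)
open import Data.Nat.Primality using (prime?; euclidsLemma)
open import Data.Nat.Tactic.RingSolver using (solve-∀)
open import Data.Integer.Base using (+_)
import Data.Integer.Properties as ℤ
open import Data.Rational.Base as ℚ using (ℚ)
open import Data.Rational.Literals using (fromℤ)
open import Data.Rational.Properties using (fromℚᵘ-cong; fromℚᵘ-toℚᵘ)
open import Data.Rational.Unnormalised.Base using (mkℚᵘ; *≡*)
open import Data.Product.Base using (_,_)
open import Data.Sum.Base using (inj₁; inj₂)
open import Relation.Binary.PropositionalEquality
  using (refl; sym; trans; cong; cong₂; subst; subst₂; module ≡-Reasoning)
open import Relation.Nullary.Decidable using (from-yes)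
open import Relation.Nullary.Negation using (contradiction)

m*d/d≡m : ∀ m {n} d .{{_ : ℕ.NonZero d}} → n ≡ m * d → + n ℚ./ d ≡ fromℤ (+ m)
m*d/d≡m m {n} d@(suc d-1) n≡m*d = trans
  (fromℚᵘ-cong {mkℚᵘ (+ n) d-1} {mkℚᵘ (+ m) 0}
    (*≡* (trans (ℤ.*-identityʳ (+ n)) (trans (cong +_ n≡m*d) (ℤ.pos-* m d)))))
  (fromℚᵘ-toℚᵘ (fromℤ (+ m)))

3^k∣m⇒k≤v₃ : ∀ {k m q} .{{q≢0 : ℚ.NonZero q}} →
             q ≡ fromℤ (+ m) → 3 ^ k ∣ m → + k ℤ.≤ v₃ q
3^k∣m⇒k≤v₃ {k} {m} {{q≢0}} refl 3^k∣m = subst (+ k ℤ.≤_)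
  (sym (ℤ.+-identityʳ _))
  (ℤ.+≤+ (v₃ℕ-greatest m {{↥-nonZero (fromℤ (+ m)) {{q≢0}}}} 3^k∣m))

m!*n!∣[m+n]! : ∀ m n → m ! * n ! ∣ (m + n) !
m!*n!∣[m+n]! m n = subst (λ k → k ! * n ! ∣ (m + n) !) (m+n∸n≡m m n)
  ([n∸k]!k!∣n! (m≤n+m n m))

[1+m]!*n!∣n*[m+n]! : ∀ m n → suc m ! * n ! ∣ n * (m + n) !
[1+m]!*n!∣n*[m+n]! m zero    = _ ∣0
[1+m]!*n!∣n*[m+n]! m (suc n) = subst₂ _∣_
  (swap (suc n) (suc m !) (n !))
  (cong (λ k → suc n * k !) (sym (+-suc m n)))
  (*-monoʳ-∣ (suc n) (m!*n!∣[m+n]! (suc m) n))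
  where
  swap : ∀ a b c → a * (b * c) ≡ b * (a * c)
  swap = solve-∀

[1+m]!*n!∣[1+m+2n]*[m+n]! : ∀ m n → suc m ! * n ! ∣ (suc (m + n) + n) * (m + n) !
[1+m]!*n!∣[1+m+2n]*[m+n]! m n = subst (suc m ! * n ! ∣_)
  (sym (*-distribʳ-+ ((m + n) !) (suc (m + n)) n))
  (∣m∣n⇒∣m+n (m!*n!∣[m+n]! (suc m) n) ([1+m]!*n!∣n*[m+n]! m n))

module _ {n t : ℕ} (t≤n : t ≤ n) where

  private
    k = n ∸ t

    n≡t+k : n ≡ t + k
    n≡t+k = sym (m+[n∸m]≡n t≤n)

    n+t≡2t+k : n + t ≡ 2 * t + k
    n+t≡2t+k = trans (cong (_+ t) n≡t+k) (lemma t k)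
      where
      lemma : ∀ t k → t + k + t ≡ 2 * t + k
      lemma = solve-∀

    2n+1≡1+2t+2k : 2 * n + 1 ≡ suc (2 * t + k) + k
    2n+1≡1+2t+2k = trans (cong (λ m → 2 * m + 1) n≡t+k) (lemma t k)
      where
      lemma : ∀ t k → 2 * (t + k) + 1 ≡ suc (2 * t + k) + k
      lemma = solve-∀

  h-denominator∣h-numerator :
    (2 * t + 1) ! * (n ∸ t) ! ∣ (2 * n + 1) * (n + t) !
  h-denominator∣h-numerator = subst₂ _∣_
    (cong (λ m → m ! * k !) (+-comm 1 (2 * t)))
    (sym (cong₂ (λ a b → a * b !) 2n+1≡1+2t+2k n+t≡2t+k))
    ([1+m]!*n!∣[1+m+2n]*[m+n]! (2 * t) k)

  2n+1∣H*[2t+1] : ∀ H →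
    (2 * n + 1) * (n + t) ! ≡ H * ((2 * t + 1) ! * (n ∸ t) !) →
    2 * n + 1 ∣ H * (2 * t + 1)
  2n+1∣H*[2t+1] H eq with m!*n!∣[m+n]! (2 * t) k
  ... | divides c [2t+k]!≡c*d = divides c (*-cancelʳ-≡ _ _ d {{(2 * t) !* k !≢0}} (begin
    H * (2 * t + 1) * d              ≡⟨ cong (λ m → H * m * d) (+-comm (2 * t) 1) ⟩
    H * suc (2 * t) * d              ≡⟨ regroup H (suc (2 * t)) ((2 * t) !) (k !) ⟩
    H * (suc (2 * t) ! * k !)        ≡⟨ cong (λ m → H * (m ! * k !)) (+-comm 1 (2 * t)) ⟩
    H * ((2 * t + 1) ! * k !)        ≡⟨ eq ⟨
    (2 * n + 1) * (n + t) !          ≡⟨ cong (λ m → (2 * n + 1) * m !) n+t≡2t+k ⟩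
    (2 * n + 1) * (2 * t + k) !      ≡⟨ cong ((2 * n + 1) *_) [2t+k]!≡c*d ⟩
    (2 * n + 1) * (c * d)            ≡⟨ *-assoc (2 * n + 1) c d ⟨
    (2 * n + 1) * c * d              ≡⟨ cong (_* d) (*-comm (2 * n + 1) c) ⟩
    c * (2 * n + 1) * d              ∎))
    where
    open ≡-Reasoning
    d = (2 * t) ! * k !
    regroup : ∀ a b c d → a * b * (c * d) ≡ a * (b * c * d)
    regroup = solve-∀

n%3≡1⇒3∣2n+1 : ∀ n → n % 3 ≡ 1 → 3 ∣ 2 * n + 1
n%3≡1⇒3∣2n+1 n n%3≡1 = divides (1 + 2 * (n / 3)) (trans
  (cong (λ m → 2 * m + 1)
    (trans (m≡m%n+[m/n]*n n 3) (cong (_+ n / 3 * 3) n%3≡1)))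
  (lemma (n / 3)))
  where
  lemma : ∀ q → 2 * (1 + q * 3) + 1 ≡ (1 + 2 * q) * 3
  lemma = solve-∀

3∣2n+1⇒n%3≡1 : ∀ n → 3 ∣ 2 * n + 1 → n % 3 ≡ 1
3∣2n+1⇒n%3≡1 n 3∣2n+1 = begin
  n % 3             ≡⟨ [m+n]%n≡m%n n 3 ⟨
  (n + 3) % 3       ≡⟨ cong (_% 3) (shift n) ⟩
  (1 + (n + 2)) % 3 ≡⟨ %-remove-+ʳ 1 3∣n+2 ⟩
  1                 ∎
  where
  open ≡-Reasoning
  shift : ∀ n → n + 3 ≡ 1 + (n + 2)
  shift = solve-∀
  sum : ∀ n → (n + 1) * 3 ≡ 2 * n + 1 + (n + 2)
  sum = solve-∀
  3∣n+2 : 3 ∣ n + 2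
  3∣n+2 = ∣m+n∣m⇒∣n (divides (n + 1) (sym (sum n))) 3∣2n+1

lemma3p2 : ∀ (n t : ℕ) → n % 3 ≡ 1 → t ≤ n →
    (t % 3 ≡ 1 → 0ℤ ℤ.≤ v₃ (h n t) {{h-nonZero n t}}) ×
    (t % 3 ≢ 1 → 1ℤ ℤ.≤ v₃ (h n t) {{h-nonZero n t}})
lemma3p2 n t n%3≡1 t≤n with h-denominator∣h-numerator t≤n
... | divides H eq =
    (λ _     → 3^k∣m⇒k≤v₃ {0} {{h-nonZero n t}} h≡H (1∣ H))
  , (λ t%3≢1 → 3^k∣m⇒k≤v₃ {1} {{h-nonZero n t}} h≡H (3∣H t%3≢1))
  where
  h≡H : h n t ≡ fromℤ (+ H)
  h≡H = m*d/d≡m H _ {{m*n≢0 _ _ {{(2 * t + 1) !≢0}} {{(n ∸ t) !≢0}}}} eq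

  3∣H : t % 3 ≢ 1 → 3 ∣ H
  3∣H t%3≢1
    with euclidsLemma H (2 * t + 1) (from-yes (prime? 3))
           (∣-trans (n%3≡1⇒3∣2n+1 n n%3≡1) (2n+1∣H*[2t+1] t≤n H eq))
  ... | inj₁ 3∣H    = 3∣H
  ... | inj₂ 3∣2t+1 = contradiction (3∣2n+1⇒n%3≡1 t 3∣2t+1) t%3≢1
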